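{- Let $G$ be a proper interval graph and $<$ a proper vertex ordering of it. Let $M=\{e_1,e_2,\ldots,e_t\}$ be a matching in $G$ where $l(e_1)<l(e_2)<\cdots<l(e_t)$. Then $M$ is uniquely restricted in $G$ if and only if $\{e_i,e_{i+1}\}$ is a uniquely restricted matching in $G$ for each $i\in\{1,2,\ldots,t-1\}$.
   Context: Graphs are finite, simple, undirected. A proper interval graph is a graph with an interval representation (closed real intervals, adjacency iff intersection for distinct vertices) in which no interval strictly contains another. An ordering $<$ of $V(G)$ is a proper vertex ordering if for all $u<v<w$, $uw\in E(G)$ implies $uv,vw\in E(G)$. For an edge $e=uv$, $l(e)=\min_<\{u,v\}$ and $r(e)=\max_<\{u,v\}$. A matching is a set of pairwise vertex-disjoint edges; it is uniquely restricted if no other matching of $G$ matches exactly the same vertex set. -}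

module Defs where

open import Level using (0ℓ)
open import Data.Nat.Base using (ℕ; suc)
open import Data.Integer.Base using (+_)
open import Data.Rational.Base as ℚ using (ℚ; _/_; ∣_∣)
open import Data.Fin.Base using (Fin)
open import Data.List.Base using (List)
open import Data.List.Relation.Unary.Any using (Any)
open import Data.List.Relation.Unary.AllPairs using (AllPairs)
import Data.List.Relation.Binary.Subset.Setoid as Subset
open import Data.Product.Base using (Σ-syntax; _×_; _,_)
open import Data.Sum.Base using (_⊎_; inj₁; inj₂)
open import Function.Bundles using (_⇔_)
open import Relation.Nullary using (¬_)
open import Relation.Unary using (Pred; _≬_; _⊥_; _⊂_; _≐_)
open import Relation.Binary.Core using (Rel)
open import Relation.Binary.Definitions using (Decidable; Symmetric; Irreflexive)
open import Relation.Binary.Bundles using (Setoid; StrictTotalOrder)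
open import Relation.Binary.Structures using (IsStrictTotalOrder)
open import Relation.Binary.PropositionalEquality using (_≡_; _≢_; refl; sym; trans)
import Relation.Binary.Properties.StrictTotalOrder as FromStrict
import Algebra.Construct.NaturalChoice.Min as Min

-- Bishop's reals: rational sequences whose k-th term (counting from k = 0)
-- is within 1/(k+1) of the limit.
record ℝ : Set where
  field
    seq     : ℕ → ℚ
    regular : ∀ j k → ∣ seq j ℚ.- seq k ∣ ℚ.≤ (+ 1 / suc j) ℚ.+ (+ 1 / suc k)

open ℝ

-- For regular sequences, the limits satisfy lim x ≤ lim y iff every pair of
-- k-th terms satisfies the inequality up to the two errors 1/(k+1).
infix 4 _≤ᴿ_
_≤ᴿ_ : Rel ℝ 0ℓ
x ≤ᴿ y = ∀ k → seq x k ℚ.≤ seq y k ℚ.+ (+ 2 / suc k)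

record ClosedInterval : Set where
  field
    lo hi : ℝ
    lo≤hi : lo ≤ᴿ hi

⟦_⟧ : ClosedInterval → Pred ℝ 0ℓ
⟦ I ⟧ x = lo ≤ᴿ x × x ≤ᴿ hi
  where open ClosedInterval I

record Graph (n : ℕ) : Set₁ where
  infix 4 _~_ _~?_
  field
    _~_      : Rel (Fin n) 0ℓ
    _~?_     : Decidable _~_
    ~-sym    : Symmetric _~_
    ~-irrefl : Irreflexive _≡_ _~_

module _ {n : ℕ} (G : Graph n) where
  open Graph G

  record ProperIntervalGraph : Set where
    field
      interval  : Fin n → ClosedInterval
      represent : ∀ {u v} → u ≢ v → (u ~ v) ⇔ (⟦ interval u ⟧ ≬ ⟦ interval v ⟧)
      proper    : ∀ u v → ¬ (⟦ interval u ⟧ ⊂ ⟦ interval v ⟧)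

  -- The ordering is arbitrary, and need not be the numerical one on Fin n.
  record ProperVertexOrdering : Set₁ where
    infix 4 _<_
    field
      _<_                : Rel (Fin n) 0ℓ
      isStrictTotalOrder : IsStrictTotalOrder _≡_ _<_
      proper             : ∀ {u v w} → u < v → v < w → u ~ w → (u ~ v) × (v ~ w)

    strictTotalOrder : StrictTotalOrder 0ℓ 0ℓ 0ℓ
    strictTotalOrder = record { isStrictTotalOrder = isStrictTotalOrder }

  -- The two ends come in some order, which is forgotten by _≈ᵉ_ below.
  record Edge : Set where
    constructor edge
    field
      end₁ end₂ : Fin n
      adjacent  : end₁ ~ end₂

  open Edge

  _≈ᵉ_ : Rel Edge 0ℓ
  e ≈ᵉ f = (end₁ e ≡ end₁ f × end₂ e ≡ end₂ f)
         ⊎ (end₁ e ≡ end₂ f × end₂ e ≡ end₁ f)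

  edgeSetoid : Setoid 0ℓ 0ℓ
  edgeSetoid = record
    { Carrier       = Edge
    ; _≈_           = _≈ᵉ_
    ; isEquivalence = record
      { refl  = inj₁ (refl , refl)
      ; sym   = λ { (inj₁ (p , q)) → inj₁ (sym p , sym q)
                  ; (inj₂ (p , q)) → inj₂ (sym q , sym p) }
      ; trans = λ { (inj₁ (p , q)) (inj₁ (r , s)) → inj₁ (trans p r , trans q s)
                  ; (inj₁ (p , q)) (inj₂ (r , s)) → inj₂ (trans p r , trans q s)
                  ; (inj₂ (p , q)) (inj₁ (r , s)) → inj₂ (trans p s , trans q r)
                  ; (inj₂ (p , q)) (inj₂ (r , s)) → inj₁ (trans p s , trans q r) }
      }
    }

  ends : Edge → Pred (Fin n) 0ℓ
  ends e v = v ≡ end₁ e ⊎ v ≡ end₂ e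

  l : ProperVertexOrdering → Edge → Fin n
  l O e = end₁ e ⊓ end₂ e
    where
    open ProperVertexOrdering O using (strictTotalOrder)
    open Min (FromStrict.totalOrder strictTotalOrder) using (_⊓_)

  -- A finite edge set is given by listing its elements; disjointness of the
  -- entries at different positions rules out repetitions.
  IsMatching : List Edge → Set
  IsMatching = AllPairs (λ e f → ends e ⊥ ends f)

  vertices : List Edge → Pred (Fin n) 0ℓ
  vertices M v = Any (λ e → ends e v) M

  -- Equality of the edge sets that two lists enumerate.
  _≋_ : Rel (List Edge) 0ℓ
  M ≋ N = M ⊆ N × N ⊆ M
    where open Subset edgeSetoid using (_⊆_)

  UniquelyRestricted : List Edge → Set
  UniquelyRestricted M =
    IsMatching M ×
    ¬ (Σ[ N ∈ List Edge ] IsMatching N × ¬ (N ≋ M) × (vertices N ≐ vertices M))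

{-# OPTIONS --safe #-}

-- For l e ≺ l f with {e, f} uniquely restricted, properness forces
-- l e ≺ r e ≺ l f ≺ r f: otherwise l e ~ l f and r e ~ r f, and these two edges
-- cover the same four vertices.  So if consecutive pairs are uniquely restricted,
-- the edges of M occupy consecutive blocks of the ordering.  Let N be a matching on
-- the same vertices and eᵢ the first edge of M missing from N.  The mates of l eᵢ
-- and r eᵢ in N are distinct and lie in later blocks, so both are at or beyond
-- l eᵢ₊₁ and one of them is at or beyond r eᵢ₊₁; properness then gives
-- l eᵢ ~ l eᵢ₊₁ and r eᵢ ~ r eᵢ₊₁, a contradiction.
-- Conversely, a second matching on the vertices of a subset of M extends, by the
-- remaining edges of M, to a second matching on the vertices of M.
module Submission where

open import Defs
open import Data.Nat.Base using (ℕ; suc)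
import Data.Nat.Base as ℕ
import Data.Nat.Properties as ℕ
open import Data.Fin.Base using (Fin; toℕ; fromℕ<; _<_)
open import Data.Fin.Properties using (_≟_; toℕ<n; toℕ-fromℕ<; toℕ-injective; <-cmp; <⇒≢)
open import Data.Fin.Induction using (<-wellFounded)
open import Data.List.Base using (List; []; _∷_; _++_; tabulate; filter)
import Data.List.Relation.Unary.All as All
open All using ([]; _∷_)
open import Data.List.Relation.Unary.Any using (here; there; any?)
import Data.List.Relation.Unary.Any.Properties as Any
open import Data.List.Relation.Unary.AllPairs using ([]; _∷_)
import Data.List.Relation.Unary.AllPairs.Properties as AllPairs
open import Data.List.Membership.Propositional using (_∈_; find; lose)
open import Data.List.Membership.Propositional.Properties
  using (∈-filter⁺; ∈-filter⁻; ∈-tabulate⁺; ∈-AllPairs₂)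
open import Data.List.Relation.Binary.Subset.Propositional using (_⊆_)
import Data.List.Membership.Setoid as SetoidMembership
open import Data.Empty using (⊥; ⊥-elim)
open import Data.Product.Base using (∃-syntax; _×_; _,_; proj₁; proj₂)
open import Data.Sum.Base using (_⊎_; inj₁; inj₂; swap)
open import Function.Bundles using (_⇔_; mk⇔)
open import Induction.WellFounded using (Acc; acc)
open import Relation.Nullary using (¬_; Dec; yes; no; contradiction)
open import Relation.Nullary.Decidable using (_⊎-dec_; ¬?)
open import Relation.Binary.Bundles using (Setoid; StrictTotalOrder)
open import Relation.Binary.Definitions using (tri<; tri≈; tri>)
import Relation.Binary.Properties.StrictTotalOrder as FromStrict
import Algebra.Construct.NaturalChoice.Min as Min
open import Relation.Binary.PropositionalEquality using (_≡_; _≢_; refl; sym; trans; cong; subst)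

module _ {n : ℕ} (G : Graph n) where
  open Graph G
  open Edge
  open SetoidMembership (edgeSetoid G) using () renaming (_∈_ to _∈ᵉ_)
  module ≈ᵉ = Setoid (edgeSetoid G)

  -- Edges as unordered pairs of ends

  -- As a datatype, unlike the sum of equations behind `_≈ᵉ_`, it lets `e`, `u` and `v` be inferred
  -- from a proof.
  data Joins (e : Edge G) (u v : Fin n) : Set where
    forward  : end₁ e ≡ u → end₂ e ≡ v → Joins e u v
    backward : end₁ e ≡ v → end₂ e ≡ u → Joins e u v

  joins-sym : ∀ {e u v} → Joins e u v → Joins e v u
  joins-sym (forward  p q) = backward p q
  joins-sym (backward p q) = forward p q

  joins⇒~ : ∀ {e u v} → Joins e u v → u ~ v
  joins⇒~ {e} (forward  refl refl) = adjacent e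
  joins⇒~ {e} (backward refl refl) = ~-sym (adjacent e)

  joins⇒≢ : ∀ {e u v} → Joins e u v → u ≢ v
  joins⇒≢ uv u≡v = ~-irrefl u≡v (joins⇒~ uv)

  joins⇒ends : ∀ {e u v} → Joins e u v → ends G e u
  joins⇒ends (forward  p _) = inj₁ (sym p)
  joins⇒ends (backward _ q) = inj₂ (sym q)

  ends⇒joins : ∀ e {u} → ends G e u → ∃[ v ] Joins e u v
  ends⇒joins e (inj₁ p) = end₂ e , forward (sym p) refl
  ends⇒joins e (inj₂ p) = end₁ e , backward refl (sym p)

  distinct-ends⇒joins : ∀ e {u v} → ends G e u → ends G e v → u ≢ v → Joins e u v
  distinct-ends⇒joins e (inj₁ refl) (inj₁ refl) u≢v = contradiction refl u≢v
  distinct-ends⇒joins e (inj₁ refl) (inj₂ refl) _   = forward refl refl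
  distinct-ends⇒joins e (inj₂ refl) (inj₁ refl) _   = backward refl refl
  distinct-ends⇒joins e (inj₂ refl) (inj₂ refl) u≢v = contradiction refl u≢v

  joins-ends : ∀ {e u v w} → Joins e u v → ends G e w → w ≡ u ⊎ w ≡ v
  joins-ends (forward  refl refl) w∈e = w∈e
  joins-ends (backward refl refl) w∈e = swap w∈e

  joins-mate : ∀ {e u v w} → Joins e u v → Joins e u w → v ≡ w
  joins-mate uv uw with joins-ends uv (joins⇒ends (joins-sym uw))
  ... | inj₁ w≡u = contradiction (sym w≡u) (joins⇒≢ uw)
  ... | inj₂ w≡v = sym w≡v

  joins-unique : ∀ {e f u v} → Joins e u v → Joins f u v → _≈ᵉ_ G e f
  joins-unique (forward  refl refl) (forward  p q) = inj₁ (sym p , sym q)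
  joins-unique (forward  refl refl) (backward p q) = inj₂ (sym q , sym p)
  joins-unique (backward refl refl) (forward  p q) = inj₂ (sym q , sym p)
  joins-unique (backward refl refl) (backward p q) = inj₁ (sym p , sym q)

  -- _≈ᵉ_ and ends unfold to equations between ends, from which Agda cannot
  -- recover the edges; hence the explicit edge arguments.
  ≈⇒joins : ∀ e f → _≈ᵉ_ G e f → Joins e (end₁ f) (end₂ f)
  ≈⇒joins e f (inj₁ (p , q)) = forward p q
  ≈⇒joins e f (inj₂ (p , q)) = backward p q

  ≈-sym : ∀ e f → _≈ᵉ_ G e f → _≈ᵉ_ G f e
  ≈-sym e f = ≈ᵉ.sym {e} {f}

  ≈-trans : ∀ e f g → _≈ᵉ_ G e f → _≈ᵉ_ G f g → _≈ᵉ_ G e g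
  ≈-trans e f g = ≈ᵉ.trans {e} {f} {g}

  ends-resp-≈ : ∀ e f {v} → _≈ᵉ_ G e f → ends G e v → ends G f v
  ends-resp-≈ e f e≈f = joins-ends (≈⇒joins e f e≈f)

  ends? : ∀ e v → Dec (ends G e v)
  ends? e v = (v ≟ end₁ e) ⊎-dec (v ≟ end₂ e)

  vertices? : ∀ M v → Dec (vertices G M v)
  vertices? M v = any? (λ e → ends? e v) M

  -- Unique restriction passes to sub-matchings

  matching-unique : ∀ {M e f v} → IsMatching G M → e ∈ M → f ∈ M →
    ends G e v → ends G f v → e ≡ f
  matching-unique M-matching e∈M f∈M v∈e v∈f with ∈-AllPairs₂ M-matching e∈M f∈M
  ... | inj₁ e≡f        = e≡f
  ... | inj₂ (inj₁ e⊥f) = contradiction (v∈e , v∈f) e⊥f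
  ... | inj₂ (inj₂ f⊥e) = contradiction (v∈f , v∈e) f⊥e

  -- A competitor `N` of `A` yields the competitor `N ++ rest` of `M`, where `rest` holds the edges
  -- of `M` outside `A`.
  uniquelyRestricted-⊆ : ∀ {A M} → IsMatching G A → A ⊆ M →
    UniquelyRestricted G M → UniquelyRestricted G A
  uniquelyRestricted-⊆ {A} {M} A-matching A⊆M (M-matching , M-unique) =
    A-matching , λ (N , N-matching , N≋̸A , N⊆A , A⊆N) → M-unique
      ( N ++ rest
      , AllPairs.++⁺ N-matching (AllPairs.filter⁺ outside? M-matching)
          (All.tabulate λ g∈N → All.tabulate λ f∈rest (v∈g , v∈f) →
            rest-disjoint f∈rest v∈f (N⊆A (lose g∈N v∈g)))
      , (λ N′≋M → N≋̸A (restrict-≋ N⊆A N′≋M))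
      , (λ v∈N′ → vertices-++⁻ N⊆A (Any.++⁻ N v∈N′))
      , λ v∈M → vertices-++⁺ A⊆N (find v∈M))
    where
    -- One end decides whether `f` lies in `A`: inside the matching `M`, an edge meeting a vertex of
    -- `A` belongs to `A`. This avoids deciding equality of edges, which carry adjacency proofs.
    outside? = λ f → ¬? (vertices? A (end₁ f))

    rest : List (Edge G)
    rest = filter outside? M

    shared⇒∈ : ∀ {f v} → f ∈ M → ends G f v → vertices G A v → f ∈ A
    shared⇒∈ f∈M v∈f v∈A with a , a∈A , v∈a ← find v∈A
      rewrite matching-unique M-matching f∈M (A⊆M a∈A) v∈f v∈a = a∈A

    rest-disjoint : ∀ {f v} → f ∈ rest → ends G f v → ¬ vertices G A v
    rest-disjoint f∈rest v∈f v∈A with f∈M , f-outside ← ∈-filter⁻ outside? {xs = M} f∈rest =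
      f-outside (lose (shared⇒∈ f∈M v∈f v∈A) (inj₁ refl))

    vertices-⊆ : ∀ {v} → vertices G A v → vertices G M v
    vertices-⊆ v∈A with a , a∈A , v∈a ← find v∈A = lose (A⊆M a∈A) v∈a

    vertices-++⁻ : ∀ {N v} → (∀ {u} → vertices G N u → vertices G A u) →
      vertices G N v ⊎ vertices G rest v → vertices G M v
    vertices-++⁻ N⊆A (inj₁ v∈N) = vertices-⊆ (N⊆A v∈N)
    vertices-++⁻ N⊆A (inj₂ v∈rest) with f , f∈rest , v∈f ← find v∈rest =
      lose (proj₁ (∈-filter⁻ outside? {xs = M} f∈rest)) v∈f

    vertices-++⁺ : ∀ {N v} → (∀ {u} → vertices G A u → vertices G N u) →
      ∃[ f ] f ∈ M × ends G f v → vertices G (N ++ rest) v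
    vertices-++⁺ {N} A⊆N (f , f∈M , v∈f) with vertices? A (end₁ f)
    ... | yes f∩A = Any.++⁺ˡ (A⊆N (lose (shared⇒∈ f∈M (inj₁ refl) f∩A) v∈f))
    ... | no  f-outside = Any.++⁺ʳ N (lose (∈-filter⁺ outside? f∈M f-outside) v∈f)

    -- An edge of `N` equals a member of `M` that meets a vertex of `A`, hence a member of `A`. An
    -- edge of `A` found in `N ++ rest` cannot come from `rest`, which avoids the vertices of `A`.
    restrict-≋ : ∀ {N} → (∀ {u} → vertices G N u → vertices G A u) →
      _≋_ G (N ++ rest) M → _≋_ G N A
    restrict-≋ {N} N⊆A (N′⊆M , M⊆N′) = (λ {g} → N⊆ᵉA {g}) , (λ {a} → A⊆ᵉN {a})
      where
      N⊆ᵉA : ∀ {g} → g ∈ᵉ N → g ∈ᵉ A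
      N⊆ᵉA {g} g∈N with find g∈N
      ... | h , h∈N , g≈h with find (N′⊆M {g} (Any.++⁺ˡ g∈N))
      ... | f , f∈M , g≈f =
        lose (shared⇒∈ f∈M (ends-resp-≈ h f (≈-trans h g f (≈-sym g h g≈h) g≈f) (inj₁ refl))
                           (N⊆A (lose h∈N (inj₁ refl))))
             g≈f

      A⊆ᵉN : ∀ {a} → a ∈ᵉ A → a ∈ᵉ N
      A⊆ᵉN {a} a∈A with find a∈A
      ... | b , b∈A , a≈b with Any.++⁻ N (M⊆N′ {a} (lose (A⊆M b∈A) a≈b))
      ... | inj₁ a∈N = a∈N
      ... | inj₂ a∈rest with f , f∈rest , a≈f ← find a∈rest =
        contradiction (lose b∈A (ends-resp-≈ a b a≈b (inj₁ refl)))
                      (rest-disjoint f∈rest (ends-resp-≈ a f a≈f (inj₁ refl)))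

  -- Exchanging the ends of two edges

  no-exchange : ∀ {e f a b c d} → UniquelyRestricted G (e ∷ f ∷ []) →
    Joins e a b → Joins f c d → a ~ c → ¬ b ~ d
  no-exchange {e} {f} {a} {b} {c} {d} (((e⊥f ∷ []) ∷ _) , unique) ab cd a~c b~d =
    unique (N , (disjoint ∷ []) ∷ [] ∷ [] , N≋̸M , N⊆M , M⊆N)
    where
    N = edge a c a~c ∷ edge b d b~d ∷ []
    M = e ∷ f ∷ []

    a∈e = joins⇒ends ab
    b∈e = joins⇒ends (joins-sym ab)
    c∈f = joins⇒ends cd
    d∈f = joins⇒ends (joins-sym cd)

    e≢f : ∀ {u v} → ends G e u → ends G f v → u ≢ v
    e≢f u∈e v∈f refl = e⊥f (u∈e , v∈f)

    disjoint : ∀ {v} → ¬ ((v ≡ a ⊎ v ≡ c) × (v ≡ b ⊎ v ≡ d))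
    disjoint (inj₁ refl , inj₁ a≡b) = joins⇒≢ ab a≡b
    disjoint (inj₁ refl , inj₂ a≡d) = e≢f a∈e d∈f a≡d
    disjoint (inj₂ refl , inj₁ c≡b) = e≢f b∈e c∈f (sym c≡b)
    disjoint (inj₂ refl , inj₂ c≡d) = joins⇒≢ cd c≡d

    N≋̸M : ¬ _≋_ G N M
    -- The edge `e` is missing from `N`: being `ac` would force `b ≡ c`, and being `bd` would force
    -- `a ≡ d`.
    N≋̸M (_ , M⊆N) with M⊆N {e} (here (≈ᵉ.refl {e}))
    ... | here ac         = e≢f b∈e c∈f (joins-mate ab (≈⇒joins e (edge a c a~c) ac))
    ... | there (here bd) = e≢f a∈e d∈f (joins-mate (joins-sym ab) (≈⇒joins e (edge b d b~d) bd))

    N⊆M : ∀ {v} → vertices G N v → vertices G M v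
    N⊆M (here (inj₁ refl))         = here a∈e
    N⊆M (here (inj₂ refl))         = there (here c∈f)
    N⊆M (there (here (inj₁ refl))) = here b∈e
    N⊆M (there (here (inj₂ refl))) = there (here d∈f)

    M⊆N : ∀ {v} → vertices G M v → vertices G N v
    M⊆N (here v∈e) with joins-ends ab v∈e
    ... | inj₁ v≡a = here (inj₁ v≡a)
    ... | inj₂ v≡b = there (here (inj₁ v≡b))
    M⊆N (there (here v∈f)) with joins-ends cd v∈f
    ... | inj₁ v≡c = here (inj₂ v≡c)
    ... | inj₂ v≡d = there (here (inj₂ v≡d))

  -- Left and right ends in a proper ordering

  module _ (O : ProperVertexOrdering G) where
    open ProperVertexOrdering O using (strictTotalOrder; proper) renaming (_<_ to _≺_)
    open StrictTotalOrder strictTotalOrder using (compare; irrefl) renaming (trans to ≺-trans)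
    open FromStrict strictTotalOrder using (totalOrder) renaming (_≤_ to _≼_)
    open Min totalOrder using (x≤y⇒x⊓y≈x; x≤y⇒y⊓x≈x)

    ≺-≼-trans : ∀ {u v w} → u ≺ v → v ≼ w → u ≺ w
    ≺-≼-trans u≺v (inj₁ v≺w)  = ≺-trans u≺v v≺w
    ≺-≼-trans u≺v (inj₂ refl) = u≺v

    ~-shrinkʳ : ∀ {u v w} → u ≺ v → v ≼ w → u ~ w → u ~ v
    ~-shrinkʳ u≺v (inj₁ v≺w)  u~w = proj₁ (proper u≺v v≺w u~w)
    ~-shrinkʳ u≺v (inj₂ refl) u~w = u~w

    ~-shrinkˡ : ∀ {u v w} → u ≺ v → v ≺ w → u ~ w → v ~ w
    ~-shrinkˡ u≺v v≺w u~w = proj₂ (proper u≺v v≺w u~w)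

    ends-comparable : ∀ (e : Edge G) → end₁ e ≺ end₂ e ⊎ end₂ e ≺ end₁ e
    ends-comparable e with compare (end₁ e) (end₂ e)
    ... | tri< e₁≺e₂ _ _ = inj₁ e₁≺e₂
    ... | tri≈ _ e₁≡e₂ _ = contradiction (adjacent e) (~-irrefl e₁≡e₂)
    ... | tri> _ _ e₂≺e₁ = inj₂ e₂≺e₁

    -- The comparison that evaluates the minimum `l` also identifies the other end, so both are
    -- obtained at once.
    splitEdge : ∀ e → ∃[ r ] l G O e ≺ r × Joins e (l G O e) r
    splitEdge e with ends-comparable e
    ... | inj₁ e₁≺e₂ = end₂ e , subst (_≺ end₂ e) (sym l≡e₁) e₁≺e₂ , forward (sym l≡e₁) refl
      where l≡e₁ = x≤y⇒x⊓y≈x (inj₁ e₁≺e₂)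
    ... | inj₂ e₂≺e₁ = end₁ e , subst (_≺ end₁ e) (sym l≡e₂) e₂≺e₁ , backward refl (sym l≡e₂)
      where l≡e₂ = x≤y⇒y⊓x≈x (inj₁ e₂≺e₁)

    r : Edge G → Fin n
    r e = proj₁ (splitEdge e)

    l≺r : ∀ e → l G O e ≺ r e
    l≺r e = proj₁ (proj₂ (splitEdge e))

    joins-lr : ∀ e → Joins e (l G O e) (r e)
    joins-lr e = proj₂ (proj₂ (splitEdge e))

    l∈ends : ∀ e → ends G e (l G O e)
    l∈ends e = joins⇒ends (joins-lr e)

    r∈ends : ∀ e → ends G e (r e)
    r∈ends e = joins⇒ends (joins-sym (joins-lr e))

    no-parallel : ∀ {e f} → UniquelyRestricted G (e ∷ f ∷ []) →
      l G O e ~ l G O f → ¬ r e ~ r f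
    no-parallel {e} {f} ur = no-exchange ur (joins-lr e) (joins-lr f)

    -- Were the left end of `f` before `r e`, properness along `e` would join it to both ends of
    -- `e`. It is then adjacent to whichever of `r e` and `r f` comes last, so properness joins
    -- these two, and `no-parallel` applies.
    separated : ∀ {e f} → UniquelyRestricted G (e ∷ f ∷ []) → l G O e ≺ l G O f → r e ≺ l G O f
    separated {e} {f} ur@(((e⊥f ∷ []) ∷ _) , _) le≺lf with compare (r e) (l G O f)
    ... | tri< re≺lf _ _ = re≺lf
    ... | tri≈ _ re≡lf _ =
      contradiction (r∈ends e , subst (ends G f) (sym re≡lf) (l∈ends f)) e⊥f
    ... | tri> _ _ lf≺re with proper le≺lf lf≺re (joins⇒~ (joins-lr e))
    ... | le~lf , lf~re = contradiction re~rf (no-parallel ur le~lf)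
      where
      re~rf : r e ~ r f
      re~rf with compare (r e) (r f)
      ... | tri< re≺rf _ _ = ~-shrinkˡ lf≺re re≺rf (joins⇒~ (joins-lr f))
      ... | tri≈ _ re≡rf _ =
        contradiction (r∈ends e , subst (ends G f) (sym re≡rf) (r∈ends f)) e⊥f
      ... | tri> _ _ rf≺re = ~-sym (~-shrinkˡ (l≺r f) rf≺re lf~re)

    -- Matchings listed by increasing left end

    module _ {t : ℕ} (e : Fin t → Edge G) (M-matching : IsMatching G (tabulate e))
             (l-mono : ∀ i j → i < j → l G O (e i) ≺ l G O (e j)) where

      e-injective : ∀ {i j} → e i ≡ e j → i ≡ j
      e-injective {i} {j} eq with <-cmp i j
      ... | tri< i<j _ _ = contradiction (l-mono i j i<j) (irrefl (cong (l G O) eq))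
      ... | tri≈ _ i≡j _ = i≡j
      ... | tri> _ _ j<i = contradiction (l-mono j i j<i) (irrefl (cong (l G O) (sym eq)))

      -- Disjointness identifies only the edges; the increasing left ends then identify their
      -- positions.
      index-unique : ∀ {i j v} → ends G (e i) v → ends G (e j) v → i ≡ j
      index-unique v∈eᵢ v∈eⱼ =
        e-injective (matching-unique M-matching (∈-tabulate⁺ _) (∈-tabulate⁺ _) v∈eᵢ v∈eⱼ)

      pairs-uniquelyRestricted : UniquelyRestricted G (tabulate e) →
        ∀ {i j} → i ≢ j → UniquelyRestricted G (e i ∷ e j ∷ [])
      pairs-uniquelyRestricted ur {i} {j} i≢j = uniquelyRestricted-⊆
        (((λ (v∈eᵢ , v∈eⱼ) → i≢j (index-unique v∈eᵢ v∈eⱼ)) ∷ []) ∷ [] ∷ [])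
        (λ { (here refl) → ∈-tabulate⁺ i ; (there (here refl)) → ∈-tabulate⁺ j })
        ur

      -- Consecutive blocks of the ordering

      module _ (consecutive : ∀ i j →
                 toℕ j ≡ suc (toℕ i) → UniquelyRestricted G (e i ∷ e j ∷ [])) where

        successor : ∀ {i j : Fin t} → i < j → ∃[ s ] toℕ s ≡ suc (toℕ i) × (s < j ⊎ s ≡ j)
        successor {i} {j} i<j = s , s≡1+i , s≤j (ℕ.m≤n⇒m<n∨m≡n i<j)
          where
          1+i<t = ℕ.≤-<-trans i<j (toℕ<n j)
          s     = fromℕ< 1+i<t
          s≡1+i = toℕ-fromℕ< 1+i<t

          s≤j : suc (toℕ i) ℕ.< toℕ j ⊎ suc (toℕ i) ≡ toℕ j → s < j ⊎ s ≡ j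
          s≤j (inj₁ 1+i<j) = inj₁ (subst (ℕ._< toℕ j) (sym s≡1+i) 1+i<j)
          s≤j (inj₂ 1+i≡j) = inj₂ (toℕ-injective (trans s≡1+i 1+i≡j))

        consecutive⇒< : ∀ {i s : Fin t} → toℕ s ≡ suc (toℕ i) → i < s
        consecutive⇒< s≡1+i = ℕ.≤-reflexive (sym s≡1+i)

        r≺l-consecutive : ∀ {i s} → toℕ s ≡ suc (toℕ i) → r (e i) ≺ l G O (e s)
        r≺l-consecutive s≡1+i =
          separated (consecutive _ _ s≡1+i) (l-mono _ _ (consecutive⇒< s≡1+i))

        r≺l : ∀ {i j} → i < j → r (e i) ≺ l G O (e j)
        r≺l {i} {j} i<j with successor i<j
        ... | s , s≡1+i , inj₁ s<j  = ≺-trans (r≺l-consecutive s≡1+i) (l-mono s j s<j)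
        ... | s , s≡1+i , inj₂ refl = r≺l-consecutive s≡1+i

        -- Meant for two distinct vertices: at most one of them is the left end of `e s`, so the
        -- other is at or beyond `r (e s)`.
        ends-beyond : ∀ {s j v} → s < j ⊎ s ≡ j → ends G (e j) v →
          v ≡ l G O (e s) ⊎ r (e s) ≼ v
        ends-beyond {s} {j} (inj₁ s<j) v∈eⱼ with joins-ends (joins-lr (e j)) v∈eⱼ
        ... | inj₁ refl = inj₂ (inj₁ (r≺l s<j))
        ... | inj₂ refl = inj₂ (inj₁ (≺-trans (r≺l s<j) (l≺r (e j))))
        ends-beyond {s} (inj₂ refl) v∈eₛ with joins-ends (joins-lr (e s)) v∈eₛ
        ... | inj₁ v≡l = inj₁ v≡l
        ... | inj₂ v≡r = inj₂ (inj₂ (sym v≡r))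

        later-mates-absurd : ∀ {i j k w w′} →
          l G O (e i) ~ w → r (e i) ~ w′ → w ≢ w′ →
          i < j → ends G (e j) w → i < k → ends G (e k) w′ → ⊥
        later-mates-absurd {i} {j} {k} {w} {w′} l~w r~w′ w≢w′ i<j w∈eⱼ i<k w′∈eₖ
          with s , s≡1+i , s≤j ← successor i<j | s′ , s′≡1+i , s′≤k ← successor i<k
          -- The successors of `i` found on the way to `j` and to `k` are the same index.
          with refl ← toℕ-injective (trans s′≡1+i (sym s≡1+i)) =
          no-parallel (consecutive i s s≡1+i)
            (~-shrinkʳ (l-mono i s (consecutive⇒< s≡1+i)) (lₛ≼ (ends-beyond s≤j w∈eⱼ)) l~w)
            (rᵢ~rₛ (ends-beyond s≤j w∈eⱼ) (ends-beyond s′≤k w′∈eₖ))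
          where
          lₛ≼ : ∀ {v} → v ≡ l G O (e s) ⊎ r (e s) ≼ v → l G O (e s) ≼ v
          lₛ≼ (inj₁ refl) = inj₂ refl
          lₛ≼ (inj₂ r≼v)  = inj₁ (≺-≼-trans (l≺r (e s)) r≼v)

          rᵢ≺rₛ : r (e i) ≺ r (e s)
          rᵢ≺rₛ = ≺-trans (r≺l-consecutive s≡1+i) (l≺r (e s))

          rᵢ~rₛ : w ≡ l G O (e s) ⊎ r (e s) ≼ w → w′ ≡ l G O (e s) ⊎ r (e s) ≼ w′ →
            r (e i) ~ r (e s)
          -- If `w′` reaches `r (e s)`, the edge from `r (e i)` is cut there. Otherwise `w` does,
          -- and the edge from the left end of `e i`, which passes over `r (e i)`, is cut on both
          -- sides.
          rᵢ~rₛ _           (inj₂ r≼w′) = ~-shrinkʳ rᵢ≺rₛ r≼w′ r~w′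
          rᵢ~rₛ (inj₂ r≼w)  (inj₁ _)    =
            ~-shrinkˡ (l≺r (e i)) rᵢ≺rₛ (~-shrinkʳ (≺-trans (l≺r (e i)) rᵢ≺rₛ) r≼w l~w)
          rᵢ~rₛ (inj₁ w≡l)  (inj₁ w′≡l) = contradiction (trans w≡l (sym w′≡l)) w≢w′

        -- Comparison with a matching on the same vertices

        module _ {N : List (Edge G)} (N-matching : IsMatching G N)
                 (N⊆M : ∀ {v} → vertices G N v → vertices G (tabulate e) v)
                 (M⊆N : ∀ {v} → vertices G (tabulate e) v → vertices G N v) where

          mate-in-N : ∀ i {v} → ends G (e i) v → ∃[ g ] ∃[ w ] g ∈ N × Joins g v w
          mate-in-N i v∈eᵢ with find (M⊆N (lose (∈-tabulate⁺ i) v∈eᵢ))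
          ... | g , g∈N , v∈g with ends⇒joins g v∈g
          ... | w , vw = g , w , g∈N , vw

          -- If `w` lay in an earlier `e j`, then `g` would be `e j`, as both are edges of `N` at
          -- `w`; so `v` would be an end of both `e i` and `e j`. If `w` lies in `e i` itself, then
          -- `g` is `e i`.
          mate-later : ∀ {i g v w} → (∀ {j} → j < i → e j ∈ᵉ N) →
            g ∈ N → Joins g v w → ends G (e i) v →
            e i ∈ᵉ N ⊎ ∃[ j ] i < j × ends G (e j) w
          mate-later {i} {g} earlier g∈N vw v∈eᵢ
            with j , w∈eⱼ ← Any.tabulate⁻ (N⊆M (lose g∈N (joins⇒ends (joins-sym vw))))
            with <-cmp i j
          ... | tri< i<j _ _ = inj₂ (j , i<j , w∈eⱼ)
          ... | tri≈ _ refl _ = inj₁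
            (lose g∈N (joins-unique (distinct-ends⇒joins (e i) v∈eᵢ w∈eⱼ (joins⇒≢ vw)) vw))
          ... | tri> _ _ j<i with h , h∈N , eⱼ≈h ← find (earlier j<i)
            with refl ← matching-unique N-matching h∈N g∈N
                          (ends-resp-≈ (e j) h eⱼ≈h w∈eⱼ) (joins⇒ends (joins-sym vw)) =
            contradiction
              (index-unique (ends-resp-≈ h (e j) (≈-sym (e j) h eⱼ≈h) (joins⇒ends vw)) v∈eᵢ)
              (<⇒≢ j<i)

          -- Strong induction on the index: a missing `e i` would have both its ends matched into
          -- later edges.
          e∈N : ∀ i → Acc _<_ i → e i ∈ᵉ N
          e∈N i (acc rs)
            with g , w , g∈N , lw ← mate-in-N i (l∈ends (e i))
               | h , w′ , h∈N , rw′ ← mate-in-N i (r∈ends (e i))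
            with mate-later (λ j<i → e∈N _ (rs j<i)) g∈N lw (l∈ends (e i))
               | mate-later (λ j<i → e∈N _ (rs j<i)) h∈N rw′ (r∈ends (e i))
          ... | inj₁ eᵢ∈N | _ = eᵢ∈N
          ... | inj₂ _ | inj₁ eᵢ∈N = eᵢ∈N
          ... | inj₂ (j , i<j , w∈eⱼ) | inj₂ (k , i<k , w′∈eₖ) = ⊥-elim
            (later-mates-absurd (joins⇒~ lw) (joins⇒~ rw′) w≢w′ i<j w∈eⱼ i<k w′∈eₖ)
            where
            w≢w′ : w ≢ w′
            -- A common mate would make `g` and `h` one edge, whose other end is both the left and
            -- the right end of `e i`.
            w≢w′ refl with refl ← matching-unique N-matching g∈N h∈N
                                    (joins⇒ends (joins-sym lw)) (joins⇒ends (joins-sym rw′)) =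
              irrefl (joins-mate (joins-sym lw) (joins-sym rw′)) (l≺r (e i))

          same-edges : _≋_ G N (tabulate e)
          same-edges = (λ {g} → N⊆ᵉM {g}) , (λ {f} → M⊆ᵉN {f})
            where
            M⊆ᵉN : ∀ {f} → f ∈ᵉ tabulate e → f ∈ᵉ N
            M⊆ᵉN {f} f∈M with i , f≈eᵢ ← Any.tabulate⁻ f∈M
              with g , g∈N , eᵢ≈g ← find (e∈N i (<-wellFounded i)) =
              lose g∈N (≈-trans f (e i) g f≈eᵢ eᵢ≈g)

            N⊆ᵉM : ∀ {g} → g ∈ᵉ N → g ∈ᵉ tabulate e
            -- An end of the edge lies in some `e i`; since `e i` is in the matching `N` too, the
            -- two edges coincide.
            N⊆ᵉM {g} g∈N with h , h∈N , g≈h ← find g∈N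
              with i , h₁∈eᵢ ← Any.tabulate⁻ (N⊆M (lose h∈N (inj₁ refl)))
              with h′ , h′∈N , eᵢ≈h′ ← find (e∈N i (<-wellFounded i))
              with refl ← matching-unique N-matching h∈N h′∈N
                          (inj₁ refl) (ends-resp-≈ (e i) h′ eᵢ≈h′ h₁∈eᵢ) =
              lose (∈-tabulate⁺ i) (≈-trans g h (e i) g≈h (≈-sym (e i) h eᵢ≈h′))

        tabulate-uniquelyRestricted : UniquelyRestricted G (tabulate e)
        tabulate-uniquelyRestricted = M-matching ,
          λ (_ , N-matching , N≋̸M , N⊆M , M⊆N) → N≋̸M (same-edges N-matching N⊆M M⊆N)

theorem3 : ∀ {n : ℕ} (G : Graph n) → ProperIntervalGraph G →
    (O : ProperVertexOrdering G) → let open ProperVertexOrdering O using () renaming (_<_ to _≺_) in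
    ∀ {t : ℕ} (e : Fin t → Edge G) → IsMatching G (tabulate e) →
    (∀ i j → i < j → l G O (e i) ≺ l G O (e j)) →
    UniquelyRestricted G (tabulate e) ⇔
    (∀ i j → toℕ j ≡ suc (toℕ i) → UniquelyRestricted G (e i ∷ e j ∷ []))
theorem3 G _ O e M-matching l-mono = mk⇔
  (λ ur i j j≡1+i → pairs-uniquelyRestricted G O e M-matching l-mono ur
    λ { refl → ℕ.1+n≢n (sym j≡1+i) })
  (tabulate-uniquelyRestricted G O e M-matching l-mono)
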